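{- For every $n\ge 3$, the hypercube graph $Q_n$ satisfies $\operatorname{nim}(\mathrm{DNT}(Q_n))=0$.
   Context: $Q_n$ is the graph whose vertices are the binary strings of length $n$, two of them being adjacent exactly when they differ in a single digit. For a graph $G$ with vertex set $V$, a set $K\subseteq V$ is convex if it contains every vertex lying on any shortest path between two elements of $K$. The convex hull $[P]$ of $P\subseteq V$ is the smallest convex set containing $P$. The game $\mathrm{DNT}(G)$: positions are the sets $P\subseteq V$ with $[V\setminus P]=V$; the starting position is $\emptyset$; the options of $P$ are the sets $P\cup\{v\}$ with $v\in V\setminus P$ and $[V\setminus(P\cup\{v\})]=V$. The nim-value of a position is defined recursively by $\operatorname{nim}(p)=\operatorname{mex}\{\operatorname{nim}(q): q\text{ an option of }p\}$, where $\operatorname{mex}(A)$ is the smallest nonnegative integer not in $A$; the nim-value of a game is that of its starting position. -}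

module Defs where

open import Data.Bool.Base using (Bool)
import Data.Bool.Properties as Bool
open import Data.Fin.Base using (Fin; zero; suc)
import Data.Fin.Properties as Fin
open import Data.Fin.Subset using (Subset; ⊥; ⁅_⁆; ∁; _∪_; _⊆_; _⊃_)
  renaming (_∈_ to _∈ˢ_)
open import Data.Fin.Subset.Induction using (⊃-wellFounded)
import Data.Fin.Subset.Properties as Subset
open import Data.List.Base using (List; []; _∷_; length; lookup; map; filter; head; last; allFin)
import Data.List.Extrema.Nat as Extrema
open import Data.List.Membership.Propositional using (_∈_; _∉_; mapWith∈)
open import Data.List.Membership.Propositional.Properties
  using (∈-filter⁻; ∈-lookup; mapWith∈-cong; mapWith∈≗map)
import Data.List.Membership.DecPropositional as DecMembership
import Data.List.Relation.Unary.All as All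
open import Data.List.Relation.Unary.AllPairs using ([]; _∷_)
open import Data.List.Relation.Unary.Any.Properties using (mapWith∈⁻)
open import Data.List.Relation.Unary.Linked using (Linked; linked?)
open import Data.List.Relation.Unary.Unique.Propositional using (Unique)
import Data.List.Relation.Unary.Unique.DecPropositional as DecUnique
open import Data.Maybe.Base using (just)
import Data.Maybe.Properties as Maybe
open import Data.Nat.Base using (ℕ; zero; suc; _≤_; _<_; _^_; z≤n; s≤s)
import Data.Nat.Properties as ℕ
open import Data.Product.Base using (Σ; ∃; _×_; _,_; proj₁; proj₂; uncurry)
open import Data.Product using (∃!)
open import Data.Product.Function.NonDependent.Propositional using (_×-↔_)
open import Data.Sum.Base using (_⊎_; inj₁; inj₂; [_,_]′)
open import Data.Vec.Base as Vec using (Vec; []; _∷_)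
open import Function.Base using (_∘_; id)
open import Function.Bundles using (_↔_; Injection; Inverse; mk↔ₛ′)
open import Function.Definitions using (Injective)
open import Function.Properties.Inverse using (↔-sym; ↔-trans; ↔⇒↣)
open import Induction.WellFounded using (WellFounded; module Subrelation; module FixPoint)
import Induction.WellFounded as WF
open import Level using (0ℓ)
open import Relation.Binary.Core using (Rel)
import Relation.Binary.Construct.On as On
open import Relation.Binary.Definitions using (Symmetric; Irreflexive; DecidableEquality)
  renaming (Decidable to Decidable₂)
open import Relation.Binary.PropositionalEquality
open import Relation.Nullary.Decidable
  using (Dec; yes; no; map′; _×-dec_; _⊎-dec_; _→-dec_; ¬?; decidable-stable; via-injection)
open import Relation.Nullary.Negation using (¬_; contradiction)
open import Relation.Unary using (Pred; Decidable)

IsMex : List ℕ → ℕ → Set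
IsMex xs k = k ∉ xs × (∀ {j} → j < k → j ∈ xs)

mexOf : ∀ xs → ∃ (IsMex xs)
mexOf xs = [ (λ below → bound , bound∉ , below) , id ]′ (search bound)
  where
  open DecMembership ℕ._≟_ using (_∈?_)

  bound : ℕ
  bound = suc (Extrema.max 0 xs)

  bound∉ : bound ∉ xs
  bound∉ b∈ = ℕ.1+n≰n (All.lookup (Extrema.xs≤max 0 xs) b∈)

  search : ∀ b → (∀ {j} → j < b → j ∈ xs) ⊎ ∃ (IsMex xs)
  search zero = inj₁ λ ()
  search (suc b) with search b
  ... | inj₂ found = inj₂ found
  ... | inj₁ below with b ∈? xs
  ...   | no b∉ = inj₂ (b , b∉ , below)
  ...   | yes b∈ = inj₁ λ j<1+b →
    [ below , (λ { refl → b∈ }) ]′ (ℕ.m≤n⇒m<n∨m≡n (ℕ.≤-pred j<1+b))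

mex : List ℕ → ℕ
mex = proj₁ ∘ mexOf

record Game : Set₁ where
  field
    Position    : Set
    start       : Position
    options     : Position → List Position
    wellFounded : WellFounded λ q p → q ∈ options p

  nimStep : ∀ p → (∀ {q} → q ∈ options p → ℕ) → ℕ
  nimStep p rec = mex (mapWith∈ (options p) rec)

  nimAt : Position → ℕ
  nimAt = WF.All.wfRec wellFounded 0ℓ (λ _ → ℕ) nimStep

  nimAt-unfold : ∀ p → nimAt p ≡ mex (map nimAt (options p))
  nimAt-unfold p = trans
    (FixPoint.unfold-wfRec wellFounded (λ _ → ℕ) nimStep
      (λ x eq → cong mex (mapWith∈-cong (options x) _ _ λ q∈ → eq q∈)))
    (cong mex (mapWith∈≗map nimAt (options p)))

nim : Game → ℕ
nim G = Game.nimAt G (Game.start G)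

record Graph : Set₁ where
  infix 4 _~_ _~?_
  field
    Vertex   : Set
    order    : ℕ
    index    : Vertex ↔ Fin order
    _~_      : Rel Vertex 0ℓ
    ~-sym    : Symmetric _~_
    ~-irrefl : Irreflexive _≡_ _~_
    _~?_     : Decidable₂ _~_

  open Inverse index public using () renaming (to to toFin; from to fromFin)

  -- Sets of vertices are bit vectors, read through the numbering of the vertices.
  VertexSet : Set
  VertexSet = Subset order

  infix 4 _∈ⱽ_ _∉ⱽ_
  _∈ⱽ_ _∉ⱽ_ : Vertex → VertexSet → Set
  v ∈ⱽ K = toFin v ∈ˢ K
  v ∉ⱽ K = ¬ v ∈ⱽ K

  -- A path is the list of its vertices, endpoints included.
  IsPath : Vertex → Vertex → List Vertex → Set
  IsPath x y vs = head vs ≡ just x × last vs ≡ just y × Linked _~_ vs × Unique vs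

  IsShortestPath : Vertex → Vertex → List Vertex → Set
  IsShortestPath x y vs =
    IsPath x y vs × (∀ ws → IsPath x y ws → length vs ≤ length ws)

  Convex : VertexSet → Set
  Convex K = ∀ x y → x ∈ⱽ K → y ∈ⱽ K →
             ∀ vs → IsShortestPath x y vs → ∀ z → z ∈ vs → z ∈ⱽ K

  infix 4 _∈Hull_
  _∈Hull_ : Vertex → VertexSet → Set
  v ∈Hull P = ∀ K → Convex K → P ⊆ K → v ∈ⱽ K

  HullIsEverything : VertexSet → Set
  HullIsEverything P = ∀ v → v ∈Hull P

  -- Paths have at most `order` vertices, so the search for shortest paths is bounded.
  private
    _≟ⱽ_ : DecidableEquality Vertex
    _≟ⱽ_ = via-injection (↔⇒↣ index) Fin._≟_

    anyVertex? : ∀ {P : Pred Vertex 0ℓ} → Decidable P → Dec (∃ P)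
    anyVertex? {P} P? = map′
      (λ (i , p) → fromFin i , p)
      (λ (v , p) → toFin v , subst P (sym (Inverse.strictlyInverseʳ index v)) p)
      (Fin.any? (P? ∘ fromFin))

    all⇐any : ∀ {a} {A : Set a} →
              (∀ {P : Pred A 0ℓ} → Decidable P → Dec (∃ P)) →
              ∀ {P : Pred A 0ℓ} → Decidable P → Dec (∀ x → P x)
    all⇐any any {P} P? = map′
      (λ ¬∃ x → decidable-stable (P? x) (λ ¬p → ¬∃ (x , ¬p)))
      (λ all (x , ¬p) → ¬p (all x))
      (¬? (any {¬_ ∘ P} (¬? ∘ P?)))

    allVertex? : ∀ {P : Pred Vertex 0ℓ} → Decidable P → Dec (∀ v → P v)
    allVertex? = all⇐any anyVertex?

    anyBoundedList? : ∀ k {P : Pred (List Vertex) 0ℓ} → Decidable P →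
                      Dec (∃ λ vs → length vs ≤ k × P vs)
    anyBoundedList? zero P? = map′
      (λ p → [] , z≤n , p)
      (λ { ([] , _ , p) → p })
      (P? [])
    anyBoundedList? (suc k) P? = map′
      (λ { (inj₁ p) → [] , z≤n , p
         ; (inj₂ (v , vs , le , p)) → v ∷ vs , s≤s le , p })
      (λ { ([] , _ , p) → inj₁ p
         ; (v ∷ vs , s≤s le , p) → inj₂ (v , vs , le , p) })
      (P? [] ⊎-dec anyVertex? λ v → anyBoundedList? k (P? ∘ (v ∷_)))

    lookup-injective : ∀ {vs : List Vertex} → Unique vs → Injective _≡_ _≡_ (lookup vs)
    lookup-injective (_  ∷ _) {zero}  {zero}  _  = refl
    lookup-injective (v∉ ∷ _) {zero}  {suc j} eq = contradiction eq (All.lookup v∉ (∈-lookup j))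
    lookup-injective (v∉ ∷ _) {suc i} {zero}  eq = contradiction (sym eq) (All.lookup v∉ (∈-lookup i))
    lookup-injective (_  ∷ u) {suc i} {suc j} eq = cong suc (lookup-injective u eq)

    length≤order : ∀ {vs} → Unique vs → length vs ≤ order
    length≤order {vs} u = Fin.injective⇒≤ {f = toFin ∘ lookup vs}
      (lookup-injective u ∘ Injection.injective (↔⇒↣ index))

    isPath? : ∀ x y → Decidable (IsPath x y)
    isPath? x y vs =
      Maybe.≡-dec _≟ⱽ_ (head vs) (just x) ×-dec
      Maybe.≡-dec _≟ⱽ_ (last vs) (just y) ×-dec
      linked? _~?_ vs ×-dec DecUnique.unique? _≟ⱽ_ vs

    allPath? : ∀ x y {P : Pred (List Vertex) 0ℓ} → Decidable P →
               Dec (∀ vs → IsPath x y vs → P vs)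
    allPath? x y {P} P? = map′ ⇒ ⇐ (¬? (anyBoundedList? order counterexample?))
      where
      Counterexample : Pred (List Vertex) 0ℓ
      Counterexample vs = IsPath x y vs × ¬ P vs

      counterexample? : Decidable Counterexample
      counterexample? vs = isPath? x y vs ×-dec ¬? (P? vs)

      ⇒ : ¬ (∃ λ vs → length vs ≤ order × Counterexample vs) → ∀ vs → IsPath x y vs → P vs
      ⇒ ¬∃ vs path@(_ , _ , _ , u) = decidable-stable (P? vs)
        λ ¬p → ¬∃ (vs , length≤order u , path , ¬p)

      ⇐ : (∀ vs → IsPath x y vs → P vs) → ¬ (∃ λ vs → length vs ≤ order × Counterexample vs)
      ⇐ all (vs , _ , path , ¬p) = ¬p (all vs path)

    convex? : Decidable Convex
    convex? K = allVertex? λ x → allVertex? λ y →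
      (toFin x Subset.∈? K) →-dec ((toFin y Subset.∈? K) →-dec
      map′ (λ f vs (path , short) → f vs path short)
           (λ f vs path short → f vs (path , short))
           (allPath? x y λ vs →
             allPath? x y (λ ws → length vs ℕ.≤? length ws) →-dec
             allVertex? λ z → DecMembership._∈?_ _≟ⱽ_ z vs →-dec (toFin z Subset.∈? K)))

  abstract
    hullIsEverything? : Decidable HullIsEverything
    hullIsEverything? P = allVertex? λ v → all⇐any Subset.anySubset? λ K →
      convex? K →-dec ((P Subset.⊆? K) →-dec (toFin v Subset.∈? K))

module _ (G : Graph) where
  open Graph G

  Legal : VertexSet → Set
  Legal P = HullIsEverything (∁ P)

  legal-⊥ : Legal ⊥
  legal-⊥ v K _ ∁⊥⊆K = ∁⊥⊆K (Subset.x∉p⇒x∈∁p Subset.∉⊥)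

  -- A move selects the vertex numbered i; `Legal P` says [V ∖ P] = V.
  CanSelect : VertexSet → Fin order → Set
  CanSelect P i = ¬ i ∈ˢ P × Legal (P ∪ ⁅ i ⁆)

  canSelect? : ∀ P → Decidable (CanSelect P)
  canSelect? P i = ¬? (i Subset.∈? P) ×-dec hullIsEverything? (∁ (P ∪ ⁅ i ⁆))

  selectable : VertexSet → List (Fin order)
  selectable P = filter (canSelect? P) (allFin order)

  select : ∀ P {i} → i ∈ selectable P → Σ VertexSet Legal
  select P {i} i∈ = P ∪ ⁅ i ⁆ , proj₂ (proj₂ (∈-filter⁻ (canSelect? P) {xs = allFin order} i∈))

  optionsDNT : Σ VertexSet Legal → List (Σ VertexSet Legal)
  optionsDNT (P , _) = mapWith∈ (selectable P) (select P)

  options-⊃ : ∀ {q} p → q ∈ optionsDNT p → proj₁ q ⊃ proj₁ p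
  options-⊃ {q} (P , _) q∈ =
    let i , i∈ , q≡ = mapWith∈⁻ (selectable P) (select P) q∈
    in subst (λ r → proj₁ r ⊃ P) (sym q≡)
         ( Subset.p⊆p∪q ⁅ i ⁆ , i , Subset.q⊆p∪q P ⁅ i ⁆ (Subset.x∈⁅x⁆ i)
         , proj₁ (proj₂ (∈-filter⁻ (canSelect? P) {xs = allFin order} i∈)))

  DNT : Game
  DNT = record
    { Position    = Σ VertexSet Legal
    ; start       = ⊥ , legal-⊥
    ; options     = optionsDNT
    ; wellFounded = Subrelation.wellFounded (λ {_} {p} → options-⊃ p)
                      (On.wellFounded proj₁ ⊃-wellFounded)
    }

DifferInOneDigit : ∀ {n} → Rel (Vec Bool n) 0ℓ
DifferInOneDigit x y = ∃! _≡_ λ i → Vec.lookup x i ≢ Vec.lookup y i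

differInOneDigit? : ∀ {n} → Decidable₂ (DifferInOneDigit {n})
differInOneDigit? x y = map′
  (λ (i , d , u) → i , d , λ {j} → u j)
  (λ (i , d , u) → i , d , λ j → u {j})
  (Fin.any? λ i → differ? i ×-dec Fin.all? λ j → differ? j →-dec (i Fin.≟ j))
  where
  differ? : Decidable λ i → Vec.lookup x i ≢ Vec.lookup y i
  differ? i = ¬? (Vec.lookup x i Bool.≟ Vec.lookup y i)

binaryStrings : ∀ n → Vec Bool n ↔ Fin (2 ^ n)
binaryStrings zero = mk↔ₛ′ (λ _ → zero) (λ _ → []) (λ { zero → refl }) (λ { [] → refl })
binaryStrings (suc n) =
  ↔-trans (mk↔ₛ′ Vec.uncons (uncurry _∷_) (λ _ → refl) (λ { (_ ∷ _) → refl }))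
  (↔-trans (↔-sym Fin.2↔Bool ×-↔ binaryStrings n) (↔-sym Fin.*↔×))

Q : ℕ → Graph
Q n = record
  { Vertex   = Vec Bool n
  ; order    = 2 ^ n
  ; index    = binaryStrings n
  ; _~_      = DifferInOneDigit
  ; ~-sym    = λ (i , d , u) → i , d ∘ sym , λ d′ → u (d′ ∘ sym)
  ; ~-irrefl = λ { refl (_ , d , _) → d refl }
  ; _~?_     = differInOneDigit?
  }

{-# OPTIONS --safe #-}
-- The second player answers every v with its antipode v̄, keeping the set P of
-- selected vertices closed under antipodes.  Suppose that P ∪ {v} is legal.  If an
-- unselected vertex x is left after the answer, then so is x̄, and the hull of
-- {x , x̄} is everything, since every vertex lies on a geodesic from x to x̄.
-- Otherwise the complement of P ∪ {v} was {v̄}, whose hull {v̄} misses v,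
-- against the legality of P ∪ {v}.
module Submission where

open import Defs
open import Data.Nat.Base using (ℕ; _≤_)
open import Relation.Binary.PropositionalEquality using (_≡_)

open import Data.Bool.Base using (Bool; true; false; not; if_then_else_; _xor_)
import Data.Bool.Properties as Bool
open import Data.Fin.Base using (Fin; zero; suc)
open import Data.Fin.Properties using (0≢1+n; suc-injective)
open import Data.Fin.Subset using (⁅_⁆; ∁; _∪_) renaming (_∈_ to _∈ˢ_)
import Data.Fin.Subset.Properties as Subset
open import Data.List.Base using (List; []; _∷_; _++_; length; map; head; last; allFin)
open import Data.List.Membership.Propositional using (_∈_)
open import Data.List.Membership.Propositional.Properties
  using (∈-filter⁺; ∈-filter⁻; ∈-allFin; ∈-map⁺; ∈-map⁻; ∈-++⁺ˡ)
import Data.List.Properties as List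
import Data.List.Relation.Unary.All as All
open import Data.List.Relation.Unary.AllPairs using ([]; _∷_)
open import Data.List.Relation.Unary.Any using (here; there)
open import Data.List.Relation.Unary.Any.Properties using (mapWith∈⁺; mapWith∈⁻)
open import Data.List.Relation.Unary.Linked as Linked using (Linked; [-]; _∷_)
import Data.List.Relation.Unary.Linked.Properties as Linked
import Data.List.Relation.Unary.Unique.Propositional.Properties as Unique
open import Data.Maybe.Base as Maybe using (just)
open import Data.Maybe.Relation.Binary.Connected using (Connected; just)
open import Data.Nat.Base using (zero; suc; _+_; _<_; z≤n; s≤s)
import Data.Nat.Properties as ℕ
open import Data.Product.Base using (∃; _×_; _,_; proj₁; proj₂)
open import Data.Sum.Base using (inj₁; inj₂; [_,_]′)
open import Data.Vec.Base as Vec using (Vec; []; _∷_; lookup)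
import Data.Vec.Properties as Vec
open import Function.Base using (_∘_)
open import Function.Bundles using (Inverse)
open import Induction.WellFounded using (Acc; acc)
open import Relation.Binary.PropositionalEquality
  using (_≢_; refl; sym; trans; cong; subst)
open import Relation.Nullary using (¬_; yes; no; contradiction)
open import Relation.Nullary.Decidable using (decidable-stable)

-- Mex and second-player strategies.

mex≡0 : ∀ {xs} → ¬ 0 ∈ xs → mex xs ≡ 0
mex≡0 {xs} 0∉ with mexOf xs
... | zero  , _         = refl
... | suc _ , _ , below = contradiction (below (s≤s z≤n)) 0∉

mex≢0 : ∀ {xs} → 0 ∈ xs → mex xs ≢ 0
mex≢0 {xs} 0∈ m≡0 = proj₁ (proj₂ (mexOf xs)) (subst (_∈ xs) (sym m≡0) 0∈)

module _ (G : Game) where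
  open Game G

  -- Abstracting nimAt to any solution of its recursion keeps it from being unfolded.
  module _ (value : Position → ℕ)
           (value-unfold : ∀ p → value p ≡ mex (map value (options p)))
           (Good : Position → Set)
           (answer : ∀ {p q} → Good p → q ∈ options p → ∃ λ r → r ∈ options q × Good r)
    where

    private
      _⊏_ : Position → Position → Set
      q ⊏ p = q ∈ options p

    -- Joint induction with `value≢0`: every option of a good position has a good option of value 0,
    -- so its mex is not 0, and 0 is missing from the values below a good position.
    value≡0 : ∀ {p} → Acc _⊏_ p → Good p → value p ≡ 0
    value≢0 : ∀ {p q} → Acc _⊏_ q → Good p → q ∈ options p → value q ≢ 0

    value≡0 {p} (acc rs) good = trans (value-unfold p) (mex≡0 λ 0∈ →
      let q , q∈ , 0≡q = ∈-map⁻ value 0∈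
      in value≢0 (rs q∈) good q∈ (sym 0≡q))

    value≢0 {q = q} (acc rs) good q∈ q≡0 with answer good q∈
    ... | r , r∈ , r-good =
      mex≢0 (subst (_∈ map value (options q)) (value≡0 (rs r∈) r-good) (∈-map⁺ value r∈))
            (trans (sym (value-unfold q)) q≡0)

  nimAt≡0 : (Good : Position → Set) →
            (∀ {p q} → Good p → q ∈ options p → ∃ λ r → r ∈ options q × Good r) →
            ∀ {p} → Good p → nimAt p ≡ 0
  nimAt≡0 Good answer {p} = value≡0 nimAt nimAt-unfold Good answer (wellFounded p)

-- Singletons and moves in an arbitrary graph.

module _ (G : Graph) where
  open Graph G

  toFin∘fromFin : ∀ i → toFin (fromFin i) ≡ i
  toFin∘fromFin = Inverse.strictlyInverseˡ index

  fromFin∘toFin : ∀ v → fromFin (toFin v) ≡ v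
  fromFin∘toFin = Inverse.strictlyInverseʳ index

  -- The one-vertex path from `x` to itself beats any list with two or more vertices.
  shortestLoop : ∀ {x vs z} → IsShortestPath x x vs → z ∈ vs → z ≡ x
  shortestLoop {x} {v ∷ []} ((refl , _) , _) (here z≡v) = z≡v
  shortestLoop {x} {_ ∷ _ ∷ _} (_ , short) _
    with short (x ∷ []) (refl , refl , [-] , All.[] ∷ [])
  ... | s≤s ()

  convex-⁅⁆ : ∀ i → Convex ⁅ i ⁆
  convex-⁅⁆ i x y x∈ y∈ vs path z z∈ =
    subst (_∈ⱽ ⁅ i ⁆) (sym z≡x) x∈
    where
    x≡y : x ≡ y
    x≡y = trans (sym (fromFin∘toFin x))
          (trans (cong fromFin (trans (Subset.x∈⁅y⁆⇒x≡y i x∈) (sym (Subset.x∈⁅y⁆⇒x≡y i y∈))))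
          (fromFin∘toFin y))

    z≡x : z ≡ x
    z≡x = shortestLoop (subst (λ w → IsShortestPath x w vs) (sym x≡y) path) z∈

  option⁻ : ∀ {p q} → q ∈ optionsDNT G p →
            ∃ λ i → ¬ i ∈ˢ proj₁ p × proj₁ q ≡ proj₁ p ∪ ⁅ i ⁆
  option⁻ {P , _} q∈ with mapWith∈⁻ (selectable G P) (select G P) q∈
  ... | i , i∈ , refl =
    i , proj₁ (proj₂ (∈-filter⁻ (canSelect? G P) {xs = allFin order} i∈)) , refl

  -- Only the vertex set of the option is pinned down: a position also carries a legality proof, and
  -- here it is whichever one `select` produces.
  option⁺ : ∀ p {i} → CanSelect G (proj₁ p) i →
            ∃ λ q → q ∈ optionsDNT G p × proj₁ q ≡ proj₁ p ∪ ⁅ i ⁆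
  option⁺ (P , _) {i} can = select G P i∈ , mapWith∈⁺ (select G P) (i , i∈ , refl) , refl
    where
    i∈ : i ∈ selectable G P
    i∈ = ∈-filter⁺ (canSelect? G P) (∈-allFin i) can

  -- The pairing strategy for an abstract antipodal map.

  module _ (antipode : Vertex → Vertex)
           (involutive : ∀ v → antipode (antipode v) ≡ v)
           (fixedPointFree : ∀ v → antipode v ≢ v)
           (spanning : ∀ K x → Convex K → x ∈ⱽ K → antipode x ∈ⱽ K → ∀ v → v ∈ⱽ K)
    where

    α : Fin order → Fin order
    α = toFin ∘ antipode ∘ fromFin

    α-involutive : ∀ i → α (α i) ≡ i
    α-involutive i =
      trans (cong (toFin ∘ antipode) (fromFin∘toFin _))
      (trans (cong toFin (involutive _)) (toFin∘fromFin i))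

    α-fixedPointFree : ∀ i → α i ≢ i
    α-fixedPointFree i αi≡i =
      fixedPointFree (fromFin i) (trans (sym (fromFin∘toFin _)) (cong fromFin αi≡i))

    Symmetric : VertexSet → Set
    Symmetric P = ∀ {i} → i ∈ˢ P → α i ∈ˢ P

    symmetric-α⁻ : ∀ {P i} → Symmetric P → α i ∈ˢ P → i ∈ˢ P
    symmetric-α⁻ {P} {i} sym-P αi∈ = subst (_∈ˢ P) (α-involutive i) (sym-P αi∈)

    symmetric-∪ : ∀ {P} i → Symmetric P → Symmetric ((P ∪ ⁅ i ⁆) ∪ ⁅ α i ⁆)
    symmetric-∪ {P} i sym-P {j} j∈ with Subset.x∈p∪q⁻ (P ∪ ⁅ i ⁆) ⁅ α i ⁆ j∈
    ... | inj₂ j∈αi rewrite Subset.x∈⁅y⁆⇒x≡y (α i) j∈αi | α-involutive i =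
      Subset.x∈p∪q⁺ (inj₁ (Subset.x∈p∪q⁺ (inj₂ (Subset.x∈⁅x⁆ i))))
    ... | inj₁ j∈Pi with Subset.x∈p∪q⁻ P ⁅ i ⁆ j∈Pi
    ...   | inj₁ j∈P = Subset.x∈p∪q⁺ (inj₁ (Subset.x∈p∪q⁺ (inj₁ (sym-P j∈P))))
    ...   | inj₂ j∈i rewrite Subset.x∈⁅y⁆⇒x≡y i j∈i = Subset.x∈p∪q⁺ (inj₂ (Subset.x∈⁅x⁆ (α i)))

    antipode-canSelect : ∀ {P i} → Symmetric P → ¬ i ∈ˢ P →
                         Legal G (P ∪ ⁅ i ⁆) → CanSelect G (P ∪ ⁅ i ⁆) (α i)
    antipode-canSelect {P} {i} sym-P i∉ legal = αi∉ , legal′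
      where
      αi∉ : ¬ α i ∈ˢ P ∪ ⁅ i ⁆
      αi∉ αi∈ with Subset.x∈p∪q⁻ P ⁅ i ⁆ αi∈
      ... | inj₁ αi∈P = i∉ (symmetric-α⁻ sym-P αi∈P)
      ... | inj₂ αi∈i = α-fixedPointFree i (Subset.x∈⁅y⁆⇒x≡y i αi∈i)

      R : VertexSet
      R = (P ∪ ⁅ i ⁆) ∪ ⁅ α i ⁆

      legal′ : Legal G R
      legal′ v K convex ∁R⊆K with Subset.nonempty? (∁ R)
      -- As `R` is symmetric, `α j` is unselected along with `j`, so `K` contains an antipodal pair.
      ... | yes (j , j∈∁R) = spanning K (fromFin j) convex
        (subst (_∈ˢ K) (sym (toFin∘fromFin j)) (∁R⊆K j∈∁R))
        (∁R⊆K (Subset.x∉p⇒x∈∁p (Subset.x∈∁p⇒x∉p j∈∁R ∘ symmetric-α⁻ (symmetric-∪ i sym-P))))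
        v
      ... | no empty = contradiction (sym i≡αi) (α-fixedPointFree i)
        where
        ∁⊆⁅αi⁆ : ∀ {j} → j ∈ˢ ∁ (P ∪ ⁅ i ⁆) → j ∈ˢ ⁅ α i ⁆
        ∁⊆⁅αi⁆ {j} j∈∁ = decidable-stable (j Subset.∈? ⁅ α i ⁆) λ j∉ →
          empty (j , Subset.x∉p⇒x∈∁p
            ([ Subset.x∈∁p⇒x∉p j∈∁ , j∉ ]′ ∘ Subset.x∈p∪q⁻ _ _))

        -- Legality before the answer is tested at the vertex `i` itself, against the convex set
        -- `⁅ α i ⁆` that contains all that was unselected.
        i≡αi : i ≡ α i
        i≡αi = trans (sym (toFin∘fromFin i))
          (Subset.x∈⁅y⁆⇒x≡y (α i) (legal (fromFin i) ⁅ α i ⁆ (convex-⁅⁆ (α i)) ∁⊆⁅αi⁆))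

    nim-DNT≡0 : nim (DNT G) ≡ 0
    nim-DNT≡0 =
      nimAt≡0 (DNT G) (Symmetric ∘ proj₁) (λ {p} {q} → answer {p} {q})
        {Game.start (DNT G)} λ i∈ → contradiction i∈ Subset.∉⊥
      where
      answer : ∀ {p q} → Symmetric (proj₁ p) → q ∈ optionsDNT G p →
               ∃ λ r → r ∈ optionsDNT G q × Symmetric (proj₁ r)
      answer {p} {Q , legal} sym-P q∈ with option⁻ {p} q∈
      ... | i , i∉ , refl
        with option⁺ (Q , legal) (antipode-canSelect sym-P i∉ legal)
      ...   | r , r∈ , r≡ = r , r∈ , subst Symmetric (sym r≡) (symmetric-∪ i sym-P)

-- Hamming distance as a lower bound for path lengths.

private variable
  n : ℕ

hamming : Vec Bool n → Vec Bool n → ℕ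
hamming []      []      = 0
hamming (a ∷ x) (b ∷ y) = (if a xor b then 1 else 0) + hamming x y

hamming-refl : (x : Vec Bool n) → hamming x x ≡ 0
hamming-refl []          = refl
hamming-refl (true  ∷ x) = hamming-refl x
hamming-refl (false ∷ x) = hamming-refl x

hamming-complement : (x : Vec Bool n) → hamming x (Vec.map not x) ≡ n
hamming-complement []          = refl
hamming-complement (true  ∷ x) = cong suc (hamming-complement x)
hamming-complement (false ∷ x) = cong suc (hamming-complement x)

lookup-ext : {x y : Vec Bool n} → (∀ i → lookup x i ≡ lookup y i) → x ≡ y
lookup-ext {x = x} {y} eq =
  trans (sym (Vec.tabulate∘lookup x)) (trans (Vec.tabulate-cong eq) (Vec.tabulate∘lookup y))

-- An edge alters one summand, and each summand is at most 1. The distance to a fixed `z` is thus a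
-- potential that drops by at most one per edge.
hamming-step : {x y : Vec Bool n} → DifferInOneDigit x y →
               ∀ z → hamming x z ≤ suc (hamming y z)
hamming-step {x = a ∷ x} {b ∷ y} (zero , _ , unique) (c ∷ z)
  -- A second difference, at `suc j`, would contradict uniqueness of the index `zero`; hence the
  -- tails coincide.
  with lookup-ext {x = x} {y} (λ j → decidable-stable (lookup x j Bool.≟ lookup y j)
         (0≢1+n ∘ unique {suc j}))
... | refl = ℕ.≤-trans (ℕ.+-monoˡ-≤ (hamming x z) (bit≤1 (a xor c))) (s≤s (ℕ.m≤n+m _ _))
  where
  bit≤1 : ∀ d → (if d then 1 else 0) ≤ 1
  bit≤1 true  = s≤s z≤n
  bit≤1 false = z≤n
hamming-step {x = a ∷ x} {b ∷ y} (suc i , d , unique) (c ∷ z)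
  with decidable-stable (a Bool.≟ b) (λ a≢b → 0≢1+n (sym (unique {zero} a≢b)))
... | refl = ℕ.≤-trans
  (ℕ.+-monoʳ-≤ (if a xor c then 1 else 0)
    (hamming-step {x = x} {y} (i , d , λ d′ → suc-injective (unique d′)) z))
  (ℕ.≤-reflexive (ℕ.+-suc _ _))

-- Sum `hamming-step` along the path. The inequality is strict because the length counts vertices,
-- one more than the edges.
hamming<length : ∀ {x y : Vec Bool n} {vs} → head vs ≡ just x → last vs ≡ just y →
                 Linked DifferInOneDigit vs → hamming x y < length vs
hamming<length refl refl ([-] {x})       = s≤s (ℕ.≤-reflexive (hamming-refl x))
hamming<length {x = x} refl last≡ (_∷_ {y = v} x~v linked) =
  s≤s (ℕ.≤-trans (hamming-step {x = x} {v} x~v _) (hamming<length refl last≡ linked))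

-- Geodesics between complementary strings.

∷-differ : ∀ a {x y : Vec Bool n} → DifferInOneDigit x y → DifferInOneDigit (a ∷ x) (a ∷ y)
∷-differ a (i , d , unique) = suc i , d , λ
  { {zero}  d′ → contradiction refl d′
  ; {suc j} d′ → cong suc (unique d′) }

flip-head : ∀ a (x : Vec Bool n) → DifferInOneDigit (a ∷ x) (not a ∷ x)
flip-head a x = zero , Bool.not-¬ refl , λ
  { {zero}  _  → refl
  ; {suc j} d′ → contradiction refl d′ }

last-∷ʳ : ∀ {A : Set} (xs : List A) {y} → last (xs ++ y ∷ []) ≡ just y
last-∷ʳ []               = refl
last-∷ʳ (_ ∷ [])         = refl
last-∷ʳ (_ ∷ xs@(_ ∷ _)) = last-∷ʳ xs

-- Keeps vertices distinct when a path lifted into one facet is extended by a vertex of the opposite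
-- facet.
not-∷∉ : ∀ {a} {x : Vec Bool n} {vs} → ¬ (not a ∷ x) ∈ map (a ∷_) vs
not-∷∉ v∈ with ∈-map⁻ _ v∈
... | _ , _ , eq = Bool.not-¬ refl (sym (Vec.∷-injectiveˡ eq))

-- Of the two edges flipping the first digit, at x or at the complement of x, the one
-- to use is determined by whether z agrees with the path's start in that digit.
antipodalPath : (x z : Vec Bool n) →
  ∃ λ vs → Graph.IsPath (Q n) x (Vec.map not x) vs × length vs ≡ suc n × z ∈ vs
antipodalPath [] [] = [] ∷ [] , (refl , refl , [-] , All.[] ∷ []) , refl , here refl
antipodalPath (a ∷ x) (c ∷ z) with antipodalPath x z | c Bool.≟ a
... | vs@(_ ∷ _) , (refl , last≡ , linked , unique) , length≡ , z∈ | yes refl =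
  map (a ∷_) vs ++ end ∷ []
  , ( refl , last-∷ʳ (map (a ∷_) vs)
    , Linked.++⁺ (Linked.map⁺ (Linked.map (∷-differ a) linked))
        -- The edge at the junction: the lifted path ends at `a ∷ Vec.map not x`, which differs from
        -- `end` in the first digit only.
        (subst (λ m → Connected _ m (just end))
          (sym (trans (List.last-map _ vs) (cong (Maybe.map (a ∷_)) last≡)))
          (just (flip-head a _)))
        [-]
    , Unique.++⁺ (Unique.map⁺ Vec.∷-injectiveʳ unique) (All.[] ∷ [])
        (λ { (v∈ , here refl) → not-∷∉ v∈ }))
  , trans (List.length-++ (map (a ∷_) vs))
      (trans (ℕ.+-comm _ 1) (cong suc (trans (List.length-map (a ∷_) vs) length≡)))
  , ∈-++⁺ˡ (∈-map⁺ (a ∷_) z∈)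
  where
  end : Vec Bool _
  end = not a ∷ Vec.map not x
... | vs@(_ ∷ _) , (refl , last≡ , linked , unique) , length≡ , z∈ | no c≢a
  with Bool.¬-not c≢a
...   | refl =
  (a ∷ x) ∷ map (not a ∷_) vs
  , ( refl
    , trans (List.last-map _ vs) (cong (Maybe.map (not a ∷_)) last≡)
    , flip-head a x ∷ Linked.map⁺ (Linked.map (∷-differ (not a)) linked)
    -- The lifted path has first digit `not a`, so `not-∷∉` excludes `not (not a) ∷ x`, which is the
    -- new start `a ∷ x`.
    , All.tabulate (λ { v∈ refl → not-∷∉ (subst (λ b → (b ∷ x) ∈ map (not a ∷_) vs)
                                           (sym (Bool.not-involutive a)) v∈) })
      ∷ Unique.map⁺ Vec.∷-injectiveʳ unique)
  , cong suc (trans (List.length-map (not a ∷_) vs) length≡)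
  , there (∈-map⁺ (not a ∷_) z∈)

-- The path through `z` has `suc n` vertices, and no path is shorter, as its ends are at Hamming
-- distance `n`.
antipodal-spanning : ∀ K (x : Vec Bool n) → let open Graph (Q n) in
  Convex K → x ∈ⱽ K → Vec.map not x ∈ⱽ K → ∀ z → z ∈ⱽ K
antipodal-spanning {n} K x convex x∈ x̄∈ z =
  let vs , path , length≡ , z∈ = antipodalPath x z
      short ws (head≡ , last≡ , linked , _) =
        subst (_≤ length ws) (trans (cong suc (hamming-complement x)) (sym length≡))
          (hamming<length head≡ last≡ linked)
  in convex x _ x∈ x̄∈ vs (path , short) z z∈

-- The complement as antipodal map of the hypercube.

complement-involutive : (x : Vec Bool n) → Vec.map not (Vec.map not x) ≡ x
complement-involutive []      = refl
complement-involutive (a ∷ x)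
  rewrite Bool.not-involutive a | complement-involutive x = refl

-- The first digit changes. The length is a successor because the empty string is its own
-- complement.
complement-fixedPointFree : (x : Vec Bool (suc n)) → Vec.map not x ≢ x
complement-fixedPointFree (a ∷ x) eq = Bool.not-¬ refl (sym (Vec.∷-injectiveˡ eq))

proposition5p6 : (n : ℕ) → 3 ≤ n → nim (DNT (Q n)) ≡ 0
proposition5p6 (suc n) _ = nim-DNT≡0 (Q (suc n)) (Vec.map not)
  complement-involutive complement-fixedPointFree antipodal-spanning
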